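{- For every fixed integer $r\ge1$, the ordinary generating function $T_r(z)=\sum_{c\ge0}T(r,c)z^c$ is a rational function of $z$.
   Context: A tatami tiling of the $r\times c$ rectangular grid is a tiling by monomers ($1\times1$ tiles) and dimers ($1\times2$ or $2\times1$ tiles) such that no point is a corner of four distinct tiles. $T(r,c)$ denotes the total number of tatami tilings of the $r\times c$ grid (with any number of monomers), with $T(r,0)=1$. -}

module Defs where

open import Data.Nat using (ℕ; zero; suc; _+_; _∸_; _≤_; _<_; _≤?_; _<?_)
import Data.Nat as ℕ
open import Data.Integer using (ℤ; 0ℤ; +_)
import Data.Integer as ℤ
open import Data.Fin using (Fin; toℕ)
import Data.Fin as Fin
open import Data.Fin.Properties using (any?; all?)
open import Data.List using (List; []; _∷_; map; foldr; upTo; length; filter; cartesianProductWith)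
open import Data.List.Properties using (filter-accept)
open import Data.List.Relation.Unary.All using (All)
import Data.List.Relation.Unary.All as All
open import Data.List.Relation.Unary.Any using (Any)
open import Data.List.Relation.Unary.AllPairs using (allPairs?)
open import Data.List.Relation.Unary.Unique.Propositional using (Unique)
open import Data.Maybe using (Maybe; just; nothing)
import Data.Maybe.Properties as Maybe
open import Data.Product using (∃; ∃!; ∃-syntax; _×_; _,_)
open import Data.Sum using (_⊎_; inj₁; inj₂)
open import Data.Vec using (Vec; []; _∷_; lookup)
open import Relation.Binary using (DecidableEquality)
open import Relation.Binary.PropositionalEquality using (_≡_; _≢_; refl; cong)
open import Relation.Nullary using (¬_; Dec; yes; no)
open import Relation.Nullary.Decidable using (map′; ¬?; _×-dec_; _⊎-dec_; _→-dec_)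
open import Relation.Unary using (Decidable)

-- `horizontal` is the 1×2 dimer and `vertical` the 2×1 dimer.
data Shape : Set where
  monomer horizontal vertical : Shape

height width : Shape → ℕ
height monomer    = 1
height horizontal = 1
height vertical   = 2
width monomer    = 1
width horizontal = 2
width vertical   = 1

-- A tile is located by its top-left cell.  Rows are numbered downwards and
-- columns rightwards; the cell (i , j) is the unit square with corners
-- (i , j), (i + 1 , j), (i , j + 1) and (i + 1 , j + 1).
record Tile (r c : ℕ) : Set where
  constructor tile
  field
    row   : Fin r
    col   : Fin c
    shape : Shape

  top left bottom right : ℕ
  top    = toℕ row
  left   = toℕ col
  bottom = top + height shape
  right  = left + width shape

open Tile public

private
  variable
    r c : ℕ

Fits : Tile r c → Set
Fits {r} {c} t = bottom t ≤ r × right t ≤ c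

Covers : Tile r c → Fin r → Fin c → Set
Covers t i j = (top t ≤ toℕ i × toℕ i < bottom t) × (left t ≤ toℕ j × toℕ j < right t)

HasCorner : Tile r c → ℕ → ℕ → Set
HasCorner t x y = (x ≡ top t ⊎ x ≡ bottom t) × (y ≡ left t ⊎ y ≡ right t)

-- A set of tiles, stored column by column: the entry in column j and row i is
-- the tile whose top-left cell is (i , j), if there is one.  Two different
-- tiles with the same top-left cell overlap, so every tiling has exactly one
-- such representation.
Layout : ℕ → ℕ → Set
Layout r c = Vec (Vec (Maybe Shape) r) c

_∈_ : Tile r c → Layout r c → Set
t ∈ S = lookup (lookup S (col t)) (row t) ≡ just (shape t)

IsTiling : Layout r c → Set
IsTiling {r} {c} S =
    (∀ t → t ∈ S → Fits t)
  × (∀ i j → ∃! _≡_ λ t → t ∈ S × Covers t i j)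

FourTilesMeetAt : Layout r c → ℕ → ℕ → Set
FourTilesMeetAt S x y =
  ∃[ t₁ ] ∃[ t₂ ] ∃[ t₃ ] ∃[ t₄ ]
    ( All (λ t → t ∈ S × HasCorner t x y) (t₁ ∷ t₂ ∷ t₃ ∷ t₄ ∷ [])
    × Unique (t₁ ∷ t₂ ∷ t₃ ∷ t₄ ∷ []))

-- The points of the grid are the (x , y) with 0 ≤ x ≤ r and 0 ≤ y ≤ c.
IsTatami : Layout r c → Set
IsTatami {r} {c} S =
  ∀ (x : Fin (suc r)) (y : Fin (suc c)) → ¬ FourTilesMeetAt S (toℕ x) (toℕ y)

IsTatamiTiling : Layout r c → Set
IsTatamiTiling S = IsTiling S × IsTatami S

_≟-Shape_ : DecidableEquality Shape
monomer    ≟-Shape monomer    = yes refl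
monomer    ≟-Shape horizontal = no λ ()
monomer    ≟-Shape vertical   = no λ ()
horizontal ≟-Shape monomer    = no λ ()
horizontal ≟-Shape horizontal = yes refl
horizontal ≟-Shape vertical   = no λ ()
vertical   ≟-Shape monomer    = no λ ()
vertical   ≟-Shape horizontal = no λ ()
vertical   ≟-Shape vertical   = yes refl

_≟-Tile_ : DecidableEquality (Tile r c)
tile i j s ≟-Tile tile i′ j′ s′ =
  map′ (λ { (refl , refl , refl) → refl }) (λ { refl → refl , refl , refl })
    (i Fin.≟ i′ ×-dec j Fin.≟ j′ ×-dec s ≟-Shape s′)

anyShape? : {P : Shape → Set} → Decidable P → Dec (∃ P)
anyShape? P? =
  map′ (λ { (inj₁ p) → monomer , p
          ; (inj₂ (inj₁ p)) → horizontal , p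
          ; (inj₂ (inj₂ p)) → vertical , p })
       (λ { (monomer , p) → inj₁ p
          ; (horizontal , p) → inj₂ (inj₁ p)
          ; (vertical , p) → inj₂ (inj₂ p) })
    (P? monomer ⊎-dec P? horizontal ⊎-dec P? vertical)

allShapes? : {P : Shape → Set} → Decidable P → Dec (∀ s → P s)
allShapes? P? =
  map′ (λ { (p , q , u) → λ { monomer → p ; horizontal → q ; vertical → u } })
       (λ f → f monomer , f horizontal , f vertical)
    (P? monomer ×-dec P? horizontal ×-dec P? vertical)

anyTile? : {P : Tile r c → Set} → Decidable P → Dec (∃ P)
anyTile? P? =
  map′ (λ { (i , j , s , p) → tile i j s , p })
       (λ { (tile i j s , p) → i , j , s , p })
    (any? λ i → any? λ j → anyShape? λ s → P? (tile i j s))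

allTiles? : {P : Tile r c → Set} → Decidable P → Dec (∀ t → P t)
allTiles? P? =
  map′ (λ { f (tile i j s) → f i j s }) (λ f i j s → f (tile i j s))
    (all? λ i → all? λ j → allShapes? λ s → P? (tile i j s))

∃!Tile? : {P : Tile r c → Set} → Decidable P → Dec (∃! _≡_ P)
∃!Tile? P? =
  map′ (λ { (t , p , u) → t , p , λ {t′} → u t′ })
       (λ { (t , p , u) → t , p , λ _ → u })
    (anyTile? λ t → P? t ×-dec allTiles? λ t′ → P? t′ →-dec t ≟-Tile t′)

_∈?_ : (t : Tile r c) (S : Layout r c) → Dec (t ∈ S)
t ∈? S = Maybe.≡-dec _≟-Shape_ (lookup (lookup S (col t)) (row t)) (just (shape t))

fits? : (t : Tile r c) → Dec (Fits t)
fits? {r} {c} t = bottom t ≤? r ×-dec right t ≤? c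

covers? : (t : Tile r c) (i : Fin r) (j : Fin c) → Dec (Covers t i j)
covers? t i j =
        (top t ≤? toℕ i ×-dec toℕ i <? bottom t)
  ×-dec (left t ≤? toℕ j ×-dec toℕ j <? right t)

hasCorner? : (t : Tile r c) (x y : ℕ) → Dec (HasCorner t x y)
hasCorner? t x y =
        (x ℕ.≟ top t ⊎-dec x ℕ.≟ bottom t)
  ×-dec (y ℕ.≟ left t ⊎-dec y ℕ.≟ right t)

isTiling? : Decidable (IsTiling {r} {c})
isTiling? S =
        allTiles? (λ t → t ∈? S →-dec fits? t)
  ×-dec all? (λ i → all? λ j → ∃!Tile? λ t → t ∈? S ×-dec covers? t i j)

fourTilesMeetAt? : (S : Layout r c) (x y : ℕ) → Dec (FourTilesMeetAt S x y)
fourTilesMeetAt? S x y =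
  anyTile? λ t₁ → anyTile? λ t₂ → anyTile? λ t₃ → anyTile? λ t₄ →
          All.all? (λ t → t ∈? S ×-dec hasCorner? t x y) (t₁ ∷ t₂ ∷ t₃ ∷ t₄ ∷ [])
    ×-dec allPairs? (λ t t′ → ¬? (t ≟-Tile t′)) (t₁ ∷ t₂ ∷ t₃ ∷ t₄ ∷ [])

isTatami? : Decidable (IsTatami {r} {c})
isTatami? S = all? λ x → all? λ y → ¬? (fourTilesMeetAt? S (toℕ x) (toℕ y))

isTatamiTiling? : Decidable (IsTatamiTiling {r} {c})
isTatamiTiling? S = isTiling? S ×-dec isTatami? S

-- Every vector of the given length with entries from a duplicate-free list,
-- each exactly once.
vectors : {A : Set} → List A → (n : ℕ) → List (Vec A n)
vectors xs zero    = [] ∷ []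
vectors xs (suc n) = cartesianProductWith _∷_ xs (vectors xs n)

layouts : (r c : ℕ) → List (Layout r c)
layouts r c = vectors (vectors entries r) c
  where
  entries : List (Maybe Shape)
  entries = nothing ∷ just monomer ∷ just horizontal ∷ just vertical ∷ []

T : ℕ → ℕ → ℕ
T r c = length (filter isTatamiTiling? (layouts r c))

-- T(r, 0) = 1 needs no separate clause: the empty layout is a tatami tiling.
T-zero : ∀ r → T r 0 ≡ 1
T-zero r = cong length (filter-accept isTatamiTiling? {x = []} {xs = []} empty)
  where
  empty : IsTatamiTiling {r} {0} []
  empty = ((λ { (tile _ () _) }) , (λ _ ()))
        , λ { _ _ (tile _ () _ , _) }

-- A formal power series Σ f(n) zⁿ is given by its coefficients.
Series : Set
Series = ℕ → ℤ

_·_ : Series → Series → Series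
(f · g) n = foldr ℤ._+_ 0ℤ (map (λ i → f i ℤ.* g (n ∸ i)) (upTo (suc n)))

-- A polynomial a₀ + a₁ z + … is the list a₀ ∷ a₁ ∷ …; trailing zeros are
-- allowed.
Polynomial : Set
Polynomial = List ℤ

⟦_⟧ : Polynomial → Series
⟦ []     ⟧ n       = 0ℤ
⟦ a ∷ p ⟧ zero    = a
⟦ a ∷ p ⟧ (suc n) = ⟦ p ⟧ n

NonZeroPoly : Polynomial → Set
NonZeroPoly = Any (_≢ 0ℤ)

-- f = p / q in the field of formal Laurent series over ℚ.  Integer
-- coefficients suffice for p and q, since ℚ(z) is the fraction field of ℤ[z].
IsRational : Series → Set
IsRational f =
  ∃[ p ] ∃[ q ] (NonZeroPoly q × (∀ n → (⟦ q ⟧ · f) n ≡ ⟦ p ⟧ n))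

generatingFunction : (ℕ → ℕ) → Series
generatingFunction a n = + a n

{-# OPTIONS --safe #-}
-- Whether a layout is a tatami tiling can be read off from its windows of three
-- consecutive columns.  Hence T r c counts the walks of length c from a fixed
-- vertex to a set of final vertices in a finite directed graph whose vertices are
-- pairs of adjacent columns.  If there are m vertices, the numbers of such walks
-- from every vertex, for m + 1 consecutive lengths, form m + 1 vectors in ℤᵐ.
-- They satisfy a nontrivial linear relation over ℤ, which persists for all larger
-- lengths and whose coefficients form the denominator.
module Submission where

open import Defs
open import Data.Nat using (ℕ; _≤_)

open import Data.Nat using (zero; suc; _+_; _∸_; _<_; _≤?_; _<?_; z≤n; s≤s; s≤s⁻¹)
import Data.Nat as ℕ
import Data.Nat.Properties as ℕ
open import Algebra.Properties.CommutativeSemigroup ℕ.+-commutativeSemigroup using (xy∙z≈xz∙y)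
open import Data.Integer using (ℤ; 0ℤ; 1ℤ; +_)
import Data.Integer as ℤ
import Data.Integer.Properties as ℤ
open import Data.Integer.Tactic.RingSolver using (solve-∀)
open import Data.Fin using (Fin; zero; suc; toℕ; fromℕ<)
open import Data.Fin.Properties using (all?; toℕ<n; toℕ-fromℕ<; toℕ-injective)
open import Data.List using (List; []; _∷_; _++_; map; foldr; upTo; applyUpTo; length; filter;
  cartesianProduct; cartesianProductWith)
open import Data.List.Membership.Propositional using () renaming (_∈_ to _∈ˡ_)
open import Data.List.Membership.Propositional.Properties using (∈-cartesianProduct⁺; ∈-cartesianProductWith⁺)
open import Data.List.Properties using (filter-++; filter-none; filter-≐; length-++; map-applyUpTo; map-cong)
open import Data.List.Relation.Unary.All as All using (All; []; _∷_)
open import Data.List.Relation.Unary.AllPairs using ([]; _∷_)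
open import Data.List.Relation.Unary.Any using (here; there)
open import Data.Maybe using (Maybe; just; nothing)
open import Data.Product using (∃!; ∃-syntax; _×_; _,_; proj₁; proj₂)
open import Data.Sum using (inj₁; inj₂; [_,_]′)
open import Data.Vec as Vec using (Vec; []; _∷_; lookup; replicate; toList)
open import Data.Vec.Properties using (lookup-replicate)
import Data.Vec.Relation.Unary.Any as VecAny
open VecAny using (here; there)
open import Data.Vec.Relation.Unary.Any.Properties using (toList⁺)
open import Function using (_∘_; id)
open import Relation.Binary.PropositionalEquality
open import Relation.Nullary using (¬_; Dec; yes; no; contradiction)
open import Relation.Nullary.Decidable using (map′; ¬?; _×-dec_; _→-dec_)
open import Relation.Unary using (Decidable)

private
  variable
    A B C : Set
    m n r c c′ : ℕ

-- Linear dependence over ℤ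

dot : Vec ℤ n → Vec (A → ℤ) n → A → ℤ
dot []       []       s = 0ℤ
dot (a ∷ as) (v ∷ vs) s = a ℤ.* v s ℤ.+ dot as vs s

NonZeroVec : Vec ℤ n → Set
NonZeroVec = VecAny.Any (_≢ 0ℤ)

dot-vanish : ∀ {s : A} (as : Vec ℤ n) {vs : Vec (A → ℤ) n} →
             (∀ i → lookup vs i s ≡ 0ℤ) → dot as vs s ≡ 0ℤ
dot-vanish []       {[]}     vs≡0 = refl
dot-vanish (a ∷ as) {v ∷ vs} vs≡0 =
  trans (cong₂ (λ x y → a ℤ.* x ℤ.+ y) (vs≡0 zero) (dot-vanish as (vs≡0 ∘ suc)))
        (trans (ℤ.+-identityʳ _) (ℤ.*-zeroʳ a))

-- Fraction-free Gaussian elimination with pivot `v s`: the result vanishes at `s` and stays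
-- integral.
combine : A → (A → ℤ) → (A → ℤ) → A → ℤ
combine s v w t = v s ℤ.* w t ℤ.- w s ℤ.* v t

-- The coefficients on the left turn a relation among the combined functions into one among
-- `v ∷ ws`; they are the `lift` of the pivot case.
dot-combine : ∀ (s : A) v (as : Vec ℤ n) ws t →
              ℤ.- dot as ws s ℤ.* v t ℤ.+ dot (Vec.map (v s ℤ.*_) as) ws t
              ≡ dot as (Vec.map (combine s v) ws) t
dot-combine s v []       []       t = refl
dot-combine s v (a ∷ as) (w ∷ ws) t =
  trans (rearrange a (w s) (dot as ws s) (v t) (v s) (w t) _)
        (cong (ℤ._+_ (a ℤ.* combine s v w t)) (dot-combine s v as ws t))
  where
  rearrange : ∀ a ws d vt vs wt e →
    ℤ.- (a ℤ.* ws ℤ.+ d) ℤ.* vt ℤ.+ (vs ℤ.* a ℤ.* wt ℤ.+ e)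
    ≡ a ℤ.* (vs ℤ.* wt ℤ.- ws ℤ.* vt) ℤ.+ (ℤ.- d ℤ.* vt ℤ.+ e)
  rearrange = solve-∀

scale-nonZero : ∀ {x} {as : Vec ℤ n} → x ≢ 0ℤ → NonZeroVec as →
                NonZeroVec (Vec.map (x ℤ.*_) as)
scale-nonZero {x = x} x≢0 (here a≢0)  = here ([ x≢0 , a≢0 ]′ ∘ ℤ.i*j≡0⇒i≡0∨j≡0 x)
scale-nonZero         x≢0 (there as≢0) = there (scale-nonZero x≢0 as≢0)

-- One elimination step: one function fewer, coordinate `s` disposed of, and nontrivial relations
-- pulled back along `lift`.
record Elimination (s : A) (vs : Vec (A → ℤ) (suc n)) : Set where
  field
    reduced  : Vec (A → ℤ) n
    vanishes : ∀ i → lookup reduced i s ≡ 0ℤ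
    lift     : Vec ℤ n → Vec ℤ (suc n)
    dot-lift : ∀ as t → dot (lift as) vs t ≡ dot as reduced t
    nonZero  : ∀ {as} → NonZeroVec as → NonZeroVec (lift as)

eliminate : ∀ (s : A) (vs : Vec (A → ℤ) (suc n)) → Elimination s vs
eliminate s (v ∷ ws) with v s ℤ.≟ 0ℤ
eliminate s (v ∷ ws) | no vs≢0 = record
  { reduced  = Vec.map (combine s v) ws
  ; vanishes = vanishes ws
  ; lift     = λ as → ℤ.- dot as ws s ∷ Vec.map (v s ℤ.*_) as
  ; dot-lift = λ as → dot-combine s v as ws
  ; nonZero  = there ∘ scale-nonZero vs≢0
  }
  where
  cancel : ∀ x y → x ℤ.* y ℤ.- y ℤ.* x ≡ 0ℤ
  cancel = solve-∀

  vanishes : ∀ (ws : Vec _ m) i → lookup (Vec.map (combine s v) ws) i s ≡ 0ℤ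
  vanishes (w ∷ ws) zero    = cancel (v s) (w s)
  vanishes (w ∷ ws) (suc i) = vanishes ws i
-- Nothing remains once `v` is dropped. The coefficient `0ℤ` gives `dot-lift`, and `nonZero` is
-- vacuous because an empty vector has no nonzero entry.
eliminate s (v ∷ []) | yes _ = record
  { reduced  = []
  ; vanishes = λ ()
  ; lift     = λ _ → 0ℤ ∷ []
  ; dot-lift = λ { [] t → refl }
  ; nonZero  = λ ()
  }
eliminate s (v ∷ ws@(_ ∷ _)) | yes vs≡0 = record
  { reduced  = v ∷ reduced
  ; vanishes = λ { zero → vs≡0 ; (suc i) → vanishes i }
  ; lift     = λ { (a ∷ as) → a ∷ lift as }
  ; dot-lift = λ { (a ∷ as) t → cong (ℤ._+_ (a ℤ.* v t)) (dot-lift as t) }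
  ; nonZero  = λ { (here a≢0) → here a≢0 ; (there as≢0) → there (nonZero as≢0) }
  }
  where open Elimination (eliminate s ws)

-- Each elimination step uses up one coordinate and one function, so a single function is left when
-- the coordinates run out.
dependence : ∀ (ss : List A) (vs : Vec (A → ℤ) (suc (length ss))) →
             ∃[ as ] NonZeroVec as × All (λ s → dot as vs s ≡ 0ℤ) ss
dependence []       (v ∷ []) = 1ℤ ∷ [] , here (λ ()) , []
dependence (s ∷ ss) vs       =
  let as , as≢0 , zeros = dependence ss reduced in
    lift as
  , nonZero as≢0
  , trans (dot-lift as s) (dot-vanish as vanishes)
    ∷ All.map (λ {t} → trans (dot-lift as t)) zeros
  where open Elimination (eliminate s vs)

-- Linear recurrences and rational series

-- The indices decrease so that a dot product with a window is a coefficient of a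
-- product of series (·-window).
window : (A → Series) → (k n : ℕ) → Vec (A → ℤ) k
window F zero    n = []
window F (suc k) n = (λ s → F s (k + n)) ∷ window F k n

·-∷-suc : ∀ a p (f : Series) n → (⟦ a ∷ p ⟧ · f) (suc n) ≡ a ℤ.* f (suc n) ℤ.+ (⟦ p ⟧ · f) n
-- The summand for index `0` splits off by computation; the others are reindexed by `suc`.
·-∷-suc a p f n = cong (λ zs → a ℤ.* f (suc n) ℤ.+ foldr ℤ._+_ 0ℤ zs)
  (trans (map-applyUpTo suc (λ i → ⟦ a ∷ p ⟧ i ℤ.* f (suc n ∸ i)) (suc n))
         (sym (map-applyUpTo id (λ i → ⟦ p ⟧ i ℤ.* f (n ∸ i)) (suc n))))

[]-· : ∀ (f : Series) n → (⟦ [] ⟧ · f) n ≡ 0ℤ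
[]-· f n = vanish (upTo (suc n))
  where
  vanish : ∀ is → foldr ℤ._+_ 0ℤ (map (λ i → 0ℤ ℤ.* f (n ∸ i)) is) ≡ 0ℤ
  vanish []       = refl
  vanish (i ∷ is) = trans (ℤ.+-identityˡ _) (vanish is)

-- The polynomial has degree at most `m`, so from index `m` on the convolution involves all of `as`.
·-window : ∀ (F : A → Series) s (as : Vec ℤ (suc m)) n →
           (⟦ toList as ⟧ · F s) (m + n) ≡ dot as (window F (suc m) n) s
·-window {m = zero} F s (a ∷ []) zero    = refl
·-window {m = zero} F s (a ∷ []) (suc n) =
  trans (·-∷-suc a [] (F s) n) (cong (ℤ._+_ (a ℤ.* F s (suc n))) ([]-· (F s) n))
·-window {m = suc m} F s (a ∷ as) n =
  trans (·-∷-suc a (toList as) (F s) (m + n))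
        (cong (ℤ._+_ (a ℤ.* F s (suc m + n))) (·-window F s as n))

⟦applyUpTo⟧ : ∀ m (g : Series) → (∀ n → g (m + n) ≡ 0ℤ) → ∀ n → g n ≡ ⟦ applyUpTo g m ⟧ n
⟦applyUpTo⟧ zero    g g≡0 n       = g≡0 n
⟦applyUpTo⟧ (suc m) g g≡0 zero    = refl
⟦applyUpTo⟧ (suc m) g g≡0 (suc n) = ⟦applyUpTo⟧ m (g ∘ suc) g≡0 n

recurrence⇒rational : ∀ (F : A → Series) s (as : Vec ℤ (suc m)) → NonZeroVec as →
                      (∀ n → dot as (window F (suc m) n) s ≡ 0ℤ) → IsRational (F s)
recurrence⇒rational {m = m} F s as as≢0 zeros =
    -- The relation is the denominator; the product with it is zero from index `m` on, and its first
    -- `m` coefficients form the numerator.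
    applyUpTo (⟦ toList as ⟧ · F s) m , toList as , toList⁺ as≢0
  , ⟦applyUpTo⟧ m _ (λ n → trans (·-window F s as n) (zeros n))

IsRational-resp : ∀ {f g : Series} → (∀ n → f n ≡ g n) → IsRational f → IsRational g
IsRational-resp f≗g (p , q , q≢0 , qf≗p) = p , q , q≢0 , λ n → trans
  (cong (foldr ℤ._+_ 0ℤ)
     (map-cong (λ i → cong (ℤ._*_ (⟦ q ⟧ i)) (sym (f≗g (n ∸ i)))) (upTo (suc n))))
  (qf≗p n)

-- Walks in a finite graph

Σ : (A → ℤ) → List A → ℤ
Σ f []       = 0ℤ
Σ f (x ∷ xs) = f x ℤ.+ Σ f xs

Σ-cong : ∀ {f g : A → ℤ} → (∀ x → f x ≡ g x) → ∀ xs → Σ f xs ≡ Σ g xs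
Σ-cong f≗g []       = refl
Σ-cong f≗g (x ∷ xs) = cong₂ ℤ._+_ (f≗g x) (Σ-cong f≗g xs)

Σ-zero : ∀ {f : A → ℤ} → (∀ x → f x ≡ 0ℤ) → ∀ xs → Σ f xs ≡ 0ℤ
Σ-zero f≗0 []       = refl
Σ-zero f≗0 (x ∷ xs) = cong₂ ℤ._+_ (f≗0 x) (Σ-zero f≗0 xs)

Σ-linear : ∀ a (f g : A → ℤ) xs → a ℤ.* Σ f xs ℤ.+ Σ g xs ≡ Σ (λ x → a ℤ.* f x ℤ.+ g x) xs
Σ-linear a f g []       = trans (ℤ.+-identityʳ _) (ℤ.*-zeroʳ a)
Σ-linear a f g (x ∷ xs) =
  trans (rearrange a (f x) (Σ f xs) (g x) (Σ g xs))
        (cong (ℤ._+_ (a ℤ.* f x ℤ.+ g x)) (Σ-linear a f g xs))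
  where
  rearrange : ∀ a u v w z → a ℤ.* (u ℤ.+ v) ℤ.+ (w ℤ.+ z)
                            ≡ a ℤ.* u ℤ.+ w ℤ.+ (a ℤ.* v ℤ.+ z)
  rearrange = solve-∀

module _ (succs : A → List A) (F : A → Series)
         (step : ∀ s n → F s (suc n) ≡ Σ (λ t → F t n) (succs s)) where

  -- Passing to the next length applies the same linear map to every entry of the window, so it
  -- commutes with forming the combination `as`.
  dot-window-suc : ∀ (as : Vec ℤ m) n s →
    dot as (window F m (suc n)) s ≡ Σ (dot as (window F m n)) (succs s)
  dot-window-suc                []       n s = sym (Σ-zero (λ _ → refl) (succs s))
  dot-window-suc {m = suc m} (a ∷ as) n s =
    trans (cong₂ (λ x y → a ℤ.* x ℤ.+ y)
             (trans (cong (F s) (ℕ.+-suc m n)) (step s (m + n)))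
             (dot-window-suc as n s))
          (Σ-linear a _ _ (succs s))

  -- The value at `s` for the next length is a sum of values at its successors, so a relation
  -- holding at all vertices at once propagates.
  dependence-persists : ∀ (as : Vec ℤ m) → (∀ s → dot as (window F m 0) s ≡ 0ℤ) →
                        ∀ n s → dot as (window F m n) s ≡ 0ℤ
  dependence-persists as zeros zero    s = zeros s
  dependence-persists as zeros (suc n) s =
    trans (dot-window-suc as n s) (Σ-zero (dependence-persists as zeros n) (succs s))

  walks-rational : (ss : List A) → (∀ s → s ∈ˡ ss) → ∀ s → IsRational (F s)
  walks-rational ss complete s =
    -- The window length is `suc (length ss)`, one more than the number of listed vertices.
    let as , as≢0 , zeros = dependence ss (window F _ 0)
    in recurrence⇒rational F s as as≢0 λ n →
         dependence-persists as (λ t → All.lookup zeros (complete t)) n s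

-- The tatami conditions at a vertical line of the grid

-- With `y` a natural number, lines can be compared across grids of different widths; at `toℕ j`
-- this unfolds to `Covers t i j`.
Covers′ : Tile r c → Fin r → ℕ → Set
Covers′ t i y = (top t ≤ toℕ i × toℕ i < bottom t) × (left t ≤ y × y < right t)

CoveredAt : Layout r c → ℕ → Set
CoveredAt S y = ∀ i → ∃! _≡_ λ t → t ∈ S × Covers′ t i y

-- The height bound of a tile is tested at the line through its right side, so each tile is tested
-- at one line only.
record EdgeAt (S : Layout r c) (y : ℕ) : Set where
  constructor edgeAt
  field
    fit    : ∀ t → t ∈ S → right t ≡ y → bottom t ≤ r
    tatami : ∀ (x : Fin (suc r)) → ¬ FourTilesMeetAt S (toℕ x) y

record Local (S : Layout r c) (y : ℕ) : Set where
  constructor local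
  field
    edge    : EdgeAt S y
    covered : CoveredAt S y

-- Line `c` has no column to its right to be covered; instead, no tile may cross it.
record Final (S : Layout r c) : Set where
  constructor final
  field
    edge   : EdgeAt S c
    right≤ : ∀ t → t ∈ S → right t ≤ c

record GoodFrom (k : ℕ) (S : Layout r c) : Set where
  constructor good
  field
    locals : ∀ {y} → k ≤ y → y < c → Local S y
    ending : Final S

open EdgeAt
open Local
open GoodFrom

edgeAt? : (S : Layout r c) (y : ℕ) → Dec (EdgeAt S y)
edgeAt? {r} S y = map′ (λ (f , t) → edgeAt f t) (λ (edgeAt f t) → f , t)
  (allTiles? (λ t → t ∈? S →-dec right t ℕ.≟ y →-dec bottom t ≤? r)
   ×-dec all? (λ x → ¬? (fourTilesMeetAt? S (toℕ x) y)))

local? : (S : Layout r c) (y : ℕ) → Dec (Local S y)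
local? S y = map′ (λ (e , c) → local e c) (λ (local e c) → e , c)
  (edgeAt? S y ×-dec all? (λ i → ∃!Tile? λ t → t ∈? S ×-dec
     (top t ≤? toℕ i ×-dec toℕ i <? bottom t) ×-dec (left t ≤? y ×-dec y <? right t)))

final? : Decidable (Final {r} {c})
final? {c = c} S = map′ (λ (e , r) → final e r) (λ (final e r) → e , r)
  (edgeAt? S c ×-dec allTiles? (λ t → t ∈? S →-dec right t ≤? c))

tiling⇒good : (S : Layout r c) → IsTatamiTiling S → GoodFrom 0 S
tiling⇒good {c = c} S ((fits , cover) , noFour) =
  good (λ _ y<c → local (edges (ℕ.<⇒≤ y<c)) (covers y<c))
       (final (edges ℕ.≤-refl) λ t t∈S → proj₂ (fits t t∈S))
  where
  edges : ∀ {y} → y ≤ c → EdgeAt S y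
  edges y≤c .fit t t∈S _ = proj₁ (fits t t∈S)
  edges y≤c .tatami x    = subst (λ y → ¬ FourTilesMeetAt S (toℕ x) y)
    (toℕ-fromℕ< (s≤s y≤c)) (noFour x (fromℕ< (s≤s y≤c)))

  covers : ∀ {y} → y < c → CoveredAt S y
  covers y<c i = subst (λ y → ∃! _≡_ λ t → t ∈ S × Covers′ t i y)
    (toℕ-fromℕ< y<c) (cover i (fromℕ< y<c))

good⇒tiling : (S : Layout r c) → GoodFrom 0 S → IsTatamiTiling S
good⇒tiling {c = c} S (good at (final end right≤)) =
    ( (λ t t∈S → edges (right≤ t t∈S) .fit t t∈S refl , right≤ t t∈S)
    , λ i j → at z≤n (toℕ<n j) .covered i)
  , λ x y → edges (s≤s⁻¹ (toℕ<n y)) .tatami x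
  where
  edges : ∀ {y} → y ≤ c → EdgeAt S y
  edges y≤c with ℕ.m≤n⇒m<n∨m≡n y≤c
  ... | inj₁ y<c  = at z≤n y<c .edge
  ... | inj₂ refl = end

-- Translation of tiles

-- The horizontal displacement y′ − y, of either sign, is written additively so
-- that the relation is symmetric and free of truncated subtraction.
data Moved (y y′ : ℕ) : Tile r c → Tile r c′ → Set where
  moved : ∀ {i : Fin r} {j : Fin c} {j′ : Fin c′} {s} → toℕ j + y′ ≡ toℕ j′ + y →
          Moved y y′ (tile i j s) (tile i j′ s)

Touches : Tile r c → ℕ → Set
Touches t y = left t ≤ y × y ≤ right t

-- Every condition at a line concerns only tiles touching it, so matches in both directions
-- transport them all.
record Match (S : Layout r c) (y : ℕ) (S′ : Layout r c′) (y′ : ℕ) : Set where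
  field
    image : ∀ t → t ∈ S → Touches t y → ∃[ t′ ] (t′ ∈ S′ × Moved y y′ t t′)

open Match

module _ {y y′ : ℕ} where

  moved-sym : {t : Tile r c} {t′ : Tile r c′} → Moved y y′ t t′ → Moved y′ y t′ t
  moved-sym (moved e) = moved (sym e)

  moved-injective : {t u : Tile r c} {t′ : Tile r c′} →
                    Moved y y′ t t′ → Moved y y′ u t′ → t ≡ u
  moved-injective (moved e) (moved e′) =
    cong (λ j → tile _ j _) (toℕ-injective (ℕ.+-cancelʳ-≡ y′ _ _ (trans e (sym e′))))

  shift-≤ : ∀ {a a′} → a + y′ ≡ a′ + y → a ≤ y → a′ ≤ y′
  shift-≤ {a} {a′} e a≤y = ℕ.+-cancelʳ-≤ y a′ y′
    (subst₂ _≤_ e (ℕ.+-comm y y′) (ℕ.+-monoˡ-≤ y′ a≤y))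

  shift-> : ∀ {a a′} → a + y′ ≡ a′ + y → y < a → y′ < a′
  shift-> {a} {a′} e y<a = ℕ.+-cancelʳ-< y y′ a′
    (subst₂ _<_ (ℕ.+-comm y y′) e (ℕ.+-monoˡ-< y′ y<a))

  shift-≡ : ∀ {a a′} → a + y′ ≡ a′ + y → y ≡ a → y′ ≡ a′
  shift-≡ {a} {a′} e refl = ℕ.+-cancelʳ-≡ y y′ a′ (trans (ℕ.+-comm y′ y) e)

  moved-right : {t : Tile r c} {t′ : Tile r c′} → Moved y y′ t t′ → right t + y′ ≡ right t′ + y
  moved-right (moved {j = j} {j′} {s} e) =
    trans (xy∙z≈xz∙y (toℕ j) (width s) y′)
      (trans (cong (_+ width s) e) (sym (xy∙z≈xz∙y (toℕ j′) (width s) y)))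

  moved-covers : {t : Tile r c} {t′ : Tile r c′} {i : Fin r} →
                 Moved y y′ t t′ → Covers′ t i y → Covers′ t′ i y′
  moved-covers mv@(moved e) (rows , l , r) = rows , shift-≤ e l , shift-> (moved-right mv) r

  moved-corner : {t : Tile r c} {t′ : Tile r c′} {x : ℕ} →
                 Moved y y′ t t′ → HasCorner t x y → HasCorner t′ x y′
  moved-corner mv@(moved e) (x≡ , inj₁ y≡) = x≡ , inj₁ (shift-≡ e y≡)
  moved-corner mv@(moved e) (x≡ , inj₂ y≡) = x≡ , inj₂ (shift-≡ (moved-right mv) y≡)

covers⇒touches : ∀ {t : Tile r c} {i y} → Covers′ t i y → Touches t y
covers⇒touches (_ , l , r) = l , ℕ.<⇒≤ r

right⇒touches : ∀ {t : Tile r c} {y} → right t ≡ y → Touches t y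
right⇒touches {t = t} refl = ℕ.m≤m+n (left t) _ , ℕ.≤-refl

corner⇒touches : ∀ {t : Tile r c} {x y} → HasCorner t x y → Touches t y
corner⇒touches {t = t} (_ , inj₁ refl) = ℕ.≤-refl , ℕ.m≤m+n (left t) _
corner⇒touches {t = t} (_ , inj₂ y≡)   = right⇒touches {t = t} (sym y≡)

module _ {S : Layout r c} {S′ : Layout r c′} {y y′ : ℕ}
         (match : Match S y S′ y′) where

  match-corner : ∀ {x} t → t ∈ S × HasCorner t x y →
                 ∃[ t′ ] ((t′ ∈ S′ × HasCorner t′ x y′) × Moved y y′ t t′)
  match-corner t (t∈S , corner) with match .image t t∈S (corner⇒touches {t = t} corner)
  ... | t′ , t′∈S′ , mv = t′ , (t′∈S′ , moved-corner mv corner) , mv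

  transport-four : ∀ {x} → FourTilesMeetAt S x y → FourTilesMeetAt S′ x y′
  transport-four (t₁ , t₂ , t₃ , t₄ , (p₁ ∷ p₂ ∷ p₃ ∷ p₄ ∷ []) ,
                  ((n₁₂ ∷ n₁₃ ∷ n₁₄ ∷ []) ∷ (n₂₃ ∷ n₂₄ ∷ []) ∷ (n₃₄ ∷ []) ∷ [] ∷ []))
    with t₁′ , q₁ , m₁ ← match-corner t₁ p₁
       | t₂′ , q₂ , m₂ ← match-corner t₂ p₂
       | t₃′ , q₃ , m₃ ← match-corner t₃ p₃
       | t₄′ , q₄ , m₄ ← match-corner t₄ p₄ =
      t₁′ , t₂′ , t₃′ , t₄′ , (q₁ ∷ q₂ ∷ q₃ ∷ q₄ ∷ [])
    , (apart m₁ m₂ n₁₂ ∷ apart m₁ m₃ n₁₃ ∷ apart m₁ m₄ n₁₄ ∷ [])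
    ∷ (apart m₂ m₃ n₂₃ ∷ apart m₂ m₄ n₂₄ ∷ [])
    ∷ (apart m₃ m₄ n₃₄ ∷ []) ∷ [] ∷ []
    where
    apart : ∀ {t u : Tile r c} {t′ u′ : Tile r c′} →
            Moved y y′ t t′ → Moved y y′ u u′ → t ≢ u → t′ ≢ u′
    apart mt mu t≢u refl = t≢u (moved-injective mt mu)

module _ {S : Layout r c} {S′ : Layout r c′} {y y′ : ℕ}
         (match : Match S y S′ y′) (match′ : Match S′ y′ S y) where

  -- Existence goes forward along `match`; a rival tile is pulled back along `match′` and identified
  -- there by uniqueness.
  transport-covered : CoveredAt S y → CoveredAt S′ y′
  transport-covered covered i with covered i
  ... | t , (t∈S , cov) , unique with match .image t t∈S (covers⇒touches {t = t} {i} cov)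
  ...   | t′ , t′∈S′ , mv = t′ , (t′∈S′ , moved-covers mv cov) , unique′
    where
    unique′ : ∀ {u′} → u′ ∈ S′ × Covers′ u′ i y′ → t′ ≡ u′
    unique′ {u′} (u′∈S′ , cov′) with match′ .image u′ u′∈S′ (covers⇒touches {t = u′} {i} cov′)
    ... | u , u∈S , mv′ with unique (u∈S , moved-covers mv′ cov′)
    ...   | refl = moved-injective (moved-sym mv) mv′

  transport-edge : EdgeAt S y → EdgeAt S′ y′
  transport-edge edge .fit t′ t′∈S′ right≡
    with match′ .image t′ t′∈S′ (right⇒touches {t = t′} right≡)
  ... | t , t∈S , mv@(moved _) = edge .fit t t∈S (sym (shift-≡ (moved-right mv) (sym right≡)))
  transport-edge edge .tatami x four = edge .tatami x (transport-four match′ four)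

  transport-local : Local S y → Local S′ y′
  transport-local (local edge covered) =
    local (transport-edge edge) (transport-covered covered)

-- Reading a layout column by column

Column : ℕ → Set
Column r = Vec (Maybe Shape) r

-- With `p` placed as column 0, its tiles do not pass line `k`. The bound is used with 2 for an
-- arbitrary column and with 0 and 1 for the empty one.
Ends≤ : ℕ → Column r → Set
Ends≤ k p = ∀ i {s} → lookup p i ≡ just s → width s ≤ k

module _ {p : Column r} {S : Layout r c} {k : ℕ} (ends : Ends≤ k p) where

  -- A tile starting in `p` stops at line `k` or before, short of `suc y`; all others are tiles of
  -- `S` shifted by one column.
  match-tail : ∀ {y} → k ≤ y → Match (p ∷ S) (suc y) S y
  match-tail k≤y .image (tile i zero s)    t∈ (_ , y<w) =
    contradiction (ℕ.≤-trans (ends i t∈) k≤y) (ℕ.<⇒≱ y<w)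
  match-tail k≤y .image (tile i (suc j) s) t∈ _ =
    tile i j s , t∈ , moved (sym (ℕ.+-suc (toℕ j) _))

  match-∷ : ∀ {y} → Match S y (p ∷ S) (suc y)
  match-∷ .image (tile i j s) t∈ _ = tile i (suc j) s , t∈ , moved (ℕ.+-suc (toℕ j) _)

  good-tail : k ≤ c → GoodFrom (suc k) (p ∷ S) → GoodFrom k S
  good-tail k≤c (good locals (final edge right≤)) = good
    (λ k≤y y<c → transport-local (match-tail k≤y) match-∷ (locals (s≤s k≤y) (s≤s y<c)))
    (final (transport-edge (match-tail k≤c) match-∷ edge)
           λ { (tile i j s) t∈ → s≤s⁻¹ (right≤ (tile i (suc j) s) t∈) })

  good-∷ : k ≤ c → GoodFrom k S → GoodFrom (suc k) (p ∷ S)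
  good-∷ k≤c (good locals (final edge right≤)) = good
    (λ { (s≤s k≤y) (s≤s y<c) → transport-local match-∷ (match-tail k≤y) (locals k≤y y<c) })
    (final (transport-edge match-∷ (match-tail k≤c) edge)
           λ { (tile i zero s)    t∈ → ℕ.≤-trans (ends i t∈) (ℕ.m≤n⇒m≤1+n k≤c)
             ; (tile i (suc j) s) t∈ → s≤s (right≤ (tile i j s) t∈) })

module _ {p q x : Column r} {S : Layout r n} where

  match-truncate : Match (p ∷ q ∷ x ∷ S) 2 (p ∷ q ∷ x ∷ []) 2
  match-truncate .image (tile i zero s)                t∈ _ = tile i zero s , t∈ , moved refl
  match-truncate .image (tile i (suc zero) s)          t∈ _ = tile i (suc zero) s , t∈ , moved refl
  match-truncate .image (tile i (suc (suc zero)) s)    t∈ _ = tile i (suc (suc zero)) s , t∈ , moved refl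
  match-truncate .image (tile i (suc (suc (suc j))) s) t∈ (s≤s (s≤s ()) , _)

  match-extend : Match (p ∷ q ∷ x ∷ []) 2 (p ∷ q ∷ x ∷ S) 2
  match-extend .image (tile i zero s)             t∈ _ = tile i zero s , t∈ , moved refl
  match-extend .image (tile i (suc zero) s)       t∈ _ = tile i (suc zero) s , t∈ , moved refl
  match-extend .image (tile i (suc (suc zero)) s) t∈ _ = tile i (suc (suc zero)) s , t∈ , moved refl

width≤2 : ∀ s → width s ≤ 2
width≤2 monomer    = s≤s z≤n
width≤2 horizontal = ℕ.≤-refl
width≤2 vertical   = s≤s z≤n

ends≤2 : (p : Column r) → Ends≤ 2 p
ends≤2 p i {s} _ = width≤2 s

-- The graph on pairs of adjacent columns

State : ℕ → Set
State r = Column r × Column r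

-- Good (p , q) S says that S completes a tiling whose last two columns are p and
-- q: the vertical lines 0 and 1 of p ∷ q ∷ S are not constrained.
Good : State r → Layout r n → Set
Good (p , q) S = GoodFrom 2 (p ∷ q ∷ S)

Window : State r → Column r → Set
Window (p , q) x = Local (p ∷ q ∷ x ∷ []) 2

window? : (s : State r) → Decidable (Window s)
window? (p , q) x = local? (p ∷ q ∷ x ∷ []) 2

good-step⁺ : ∀ {p q x : Column r} {S : Layout r n} →
             Window (p , q) x → Good (q , x) S → Good (p , q) (x ∷ S)
good-step⁺ {p = p} {q} {x} {S} w g = good at (g′ .ending)
  where
  g′ : GoodFrom 3 (p ∷ q ∷ x ∷ S)
  g′ = good-∷ (ends≤2 p) (s≤s (s≤s z≤n)) g

  at : ∀ {y} → 2 ≤ y → y < _ → Local (p ∷ q ∷ x ∷ S) y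
  at 2≤y y<c with ℕ.m≤n⇒m<n∨m≡n 2≤y
  ... | inj₁ 2<y  = g′ .locals 2<y y<c
  ... | inj₂ refl = transport-local match-extend match-truncate w

good-step⁻ : ∀ {p q x : Column r} {S : Layout r n} →
             Good (p , q) (x ∷ S) → Window (p , q) x × Good (q , x) S
good-step⁻ {p = p} (good locals ending) =
    transport-local match-truncate match-extend (locals ℕ.≤-refl (s≤s (s≤s (s≤s z≤n))))
  , good-tail (ends≤2 p) (s≤s (s≤s z≤n)) (good (λ 3≤y → locals (ℕ.<⇒≤ 3≤y)) ending)

good? : (s : State r) → Decidable (Good {n = n} s)
good? (p , q) []      =
  -- No line satisfies `2 ≤ y < 2`, so only the condition on final vertices remains.
  map′ (good λ 2≤y y<2 → contradiction y<2 (ℕ.≤⇒≯ 2≤y)) ending (final? (p ∷ q ∷ []))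
good? (p , q) (x ∷ S) =
  map′ (λ (w , g) → good-step⁺ w g) good-step⁻ (window? (p , q) x ×-dec good? (q , x) S)

∅ : Column r
∅ = replicate _ nothing

ends-∅ : ∀ {k} → Ends≤ {r} k ∅
ends-∅ i e with trans (sym (lookup-replicate i nothing)) e
... | ()

tiling⇒good-∅ : (S : Layout r c) → IsTatamiTiling S → Good (∅ , ∅) S
tiling⇒good-∅ S = good-∷ ends-∅ (s≤s z≤n) ∘ good-∷ ends-∅ z≤n ∘ tiling⇒good S

good-∅⇒tiling : (S : Layout r c) → Good (∅ , ∅) S → IsTatamiTiling S
good-∅⇒tiling S = good⇒tiling S ∘ good-tail ends-∅ z≤n ∘ good-tail ends-∅ (s≤s z≤n)

-- Counting

count : {P : A → Set} → Decidable P → List A → ℤ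
count P? xs = + length (filter P? xs)

count-cong : {P Q : A → Set} (P? : Decidable P) (Q? : Decidable Q) →
             (∀ {x} → P x → Q x) → (∀ {x} → Q x → P x) → ∀ xs → count P? xs ≡ count Q? xs
count-cong P? Q? P⇒Q Q⇒P xs = cong (λ ys → + length ys) (filter-≐ P? Q? (P⇒Q , Q⇒P) xs)

count-none : {P : A → Set} (P? : Decidable P) → (∀ x → ¬ P x) → ∀ xs → count P? xs ≡ 0ℤ
count-none P? ¬P xs = cong (λ ys → + length ys) (filter-none P? (All.universal ¬P xs))

count-++ : {P : A → Set} (P? : Decidable P) → ∀ xs ys → count P? (xs ++ ys) ≡ count P? xs ℤ.+ count P? ys
count-++ P? xs ys = trans
  (cong +_ (trans (cong length (filter-++ P? xs ys)) (length-++ (filter P? xs))))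
  (ℤ.pos-+ (length (filter P? xs)) _)

count-map : {P : B → Set} (P? : Decidable P) (f : A → B) → ∀ xs → count P? (map f xs) ≡ count (P? ∘ f) xs
count-map P? f []       = refl
count-map P? f (x ∷ xs) with P? (f x)
... | yes _ = cong ℤ.suc (count-map P? f xs)
... | no _  = count-map P? f xs

count-product : {P : C → Set} (P? : Decidable P) (f : A → B → C) → ∀ xs ys →
                count P? (cartesianProductWith f xs ys) ≡ Σ (λ x → count (P? ∘ f x) ys) xs
count-product P? f []       ys = refl
count-product P? f (x ∷ xs) ys = trans (count-++ P? (map (f x) ys) _)
  (cong₂ ℤ._+_ (count-map P? (f x) ys) (count-product P? f xs ys))

Σ-map : ∀ (f : B → ℤ) (g : A → B) xs → Σ f (map g xs) ≡ Σ (f ∘ g) xs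
Σ-map f g []       = refl
Σ-map f g (x ∷ xs) = cong (ℤ._+_ (f (g x))) (Σ-map f g xs)

Σ-filter : {P : A → Set} (P? : Decidable P) {f g : A → ℤ} →
           (∀ {x} → P x → f x ≡ g x) → (∀ {x} → ¬ P x → f x ≡ 0ℤ) →
           ∀ xs → Σ f xs ≡ Σ g (filter P? xs)
Σ-filter P? f≡g f≡0 []       = refl
Σ-filter P? f≡g f≡0 (x ∷ xs) with P? x
... | yes Px = cong₂ ℤ._+_ (f≡g Px) (Σ-filter P? f≡g f≡0 xs)
... | no ¬Px = trans (cong₂ ℤ._+_ (f≡0 ¬Px) (Σ-filter P? f≡g f≡0 xs)) (ℤ.+-identityˡ _)

-- Completions as walks

entries : List (Maybe Shape)
entries = nothing ∷ just monomer ∷ just horizontal ∷ just vertical ∷ []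

entries-complete : ∀ e → e ∈ˡ entries
entries-complete nothing           = here refl
entries-complete (just monomer)    = there (here refl)
entries-complete (just horizontal) = there (there (here refl))
entries-complete (just vertical)   = there (there (there (here refl)))

vectors-complete : {xs : List A} → (∀ x → x ∈ˡ xs) → ∀ (v : Vec A n) → v ∈ˡ vectors xs n
vectors-complete complete []      = here refl
vectors-complete complete (x ∷ v) =
  ∈-cartesianProductWith⁺ _∷_ (complete x) (vectors-complete complete v)

columns : ∀ r → List (Column r)
columns r = vectors entries r

columns-complete : (p : Column r) → p ∈ˡ columns r
columns-complete = vectors-complete entries-complete

states-complete : (s : State r) → s ∈ˡ cartesianProduct (columns r) (columns r)
states-complete (p , q) = ∈-cartesianProduct⁺ (columns-complete p) (columns-complete q)

succs : State r → List (State r)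
succs s@(_ , q) = map (q ,_) (filter (window? s) (columns _))

-- These are the walks of length `n` from `s` to a final vertex, counted as layouts for direct
-- comparison with `T`.
completions : State r → Series
completions s n = count (good? s) (vectors (columns _) n)

completions-suc : ∀ (s : State r) n → completions s (suc n) ≡ Σ (λ t → completions t n) (succs s)
completions-suc {r} s@(p , q) n = begin
  count (good? s) (vectors (columns r) (suc n))
    ≡⟨ count-product (good? s) _∷_ (columns r) rest ⟩
  Σ (λ x → count (good? s ∘ (x ∷_)) rest) (columns r)
    -- A column `x` allowed by the window leads to the vertex `(q , x)`; any other admits no
    -- completion.
    ≡⟨ Σ-filter (window? s)
         (λ {x} w → count-cong (good? s ∘ (x ∷_)) (good? (q , x)) (proj₂ ∘ good-step⁻) (good-step⁺ w) rest)
         (λ {x} ¬w → count-none (good? s ∘ (x ∷_)) (λ _ → ¬w ∘ proj₁ ∘ good-step⁻) rest)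
         (columns r) ⟩
  Σ (λ x → completions (q , x) n) (filter (window? s) (columns r))
    ≡⟨ Σ-map (λ t → completions t n) (q ,_) (filter (window? s) (columns r)) ⟨
  Σ (λ t → completions t n) (succs s) ∎
  where
  open ≡-Reasoning
  rest = vectors (columns r) n

T-completions : ∀ r c → completions {r} (∅ , ∅) c ≡ + T r c
T-completions r c =
  -- `layouts r c` unfolds to `vectors (columns r) c`, since `entries` repeats the list local to
  -- `layouts`.
  count-cong (good? _) isTatamiTiling? (good-∅⇒tiling _) (tiling⇒good-∅ _) (layouts r c)

theorem3 : (r : ℕ) → 1 ≤ r → IsRational (generatingFunction (T r))
theorem3 r _ = IsRational-resp (T-completions r)
  (walks-rational succs completions completions-suc _ states-complete (∅ , ∅))
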